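{- Let $\pi(p)$ be a unary DLE-term positive in $p$, and let $A$ be a DLE. If $A\models\pi(p\vee q)\le\pi(p)\vee\pi(q)$, then $$A^\delta\models \forall\mathbf m\,[\pi(\bot)\le\mathbf m\ \Rightarrow\ \pi(\blacksquare_\pi\mathbf m)\le\mathbf m],$$ that is, for every completely meet-irreducible element $m\in M^\infty(A^\delta)$, if $\pi^{A^\delta}(\bot)\le m$ then $\pi^{A^\delta}(\blacksquare_\pi m)\le m$, where $\blacksquare_\pi u:=\bigvee\{i\in J^\infty(A^\delta)\mid\pi^{A^\delta}(i)\le u\}$ for $u\in A^\delta$.
   Context: Fix disjoint sets $\mathcal F,\mathcal G$ of connectives; each $f\in\mathcal F$ (resp. $g\in\mathcal G$) has an arity $n_f$ (resp. $n_g$) and an order-type $\varepsilon_f\in\{1,\partial\}^{n_f}$ (resp. $\varepsilon_g\in\{1,\partial\}^{n_g}$). DLE-terms are built from propositional variables and $\bot,\top$ by $\wedge,\vee$ and the connectives in $\mathcal F\cup\mathcal G$. A DLE (normal distributive lattice expansion) is a bounded distributive lattice (BDL) $A$ with operations $f^A,g^A$ of the given arities such that, in each coordinate $i$: $f^A$ preserves finite (including empty) joins if $\varepsilon_f(i)=1$ and sends finite (including empty) meets to joins if $\varepsilon_f(i)=\partial$; $g^A$ preserves finite (including empty) meets if $\varepsilon_g(i)=1$ and sends finite (including empty) joins to meets if $\varepsilon_g(i)=\partial$. $A\models s\le t$ means that $s\le t$ holds in $A$ under every assignment of the variables to elements of $A$. A term is positive in $p$ if every occurrence of $p$ lies under an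 even number of argument places of order-type $\partial$ ($\wedge,\vee$ have order-type $1$ in both arguments). The canonical extension of a BDL $A$ is the (unique up to isomorphism) complete BDL $A^\delta$ containing $A$ as a sublattice such that every element of $A^\delta$ is both a join of meets and a meet of joins of elements of $A$, and for all $S,T\subseteq A$ with $\bigwedge S\le\bigvee T$ in $A^\delta$ there are finite $F\subseteq S$, $G\subseteq T$ with $\bigwedge F\le\bigvee G$. $K(A^\delta)$ is the set of meets, $O(A^\delta)$ the set of joins, of subsets of $A$; $J^\infty(A^\delta)$ (resp. $M^\infty(A^\delta)$) is the set of completely join-irreducible (resp. completely meet-irreducible) elements of $A^\delta$. For order-preserving $h:A\to B$ and $u\in A^\delta$, $h^\sigma(u)=\bigvee\{\bigwedge\{h(a): x\le a\in A\}: u\ge x\in K(A^\delta)\}$ and $h^\pi(u)=\bigwedge\{\bigvee\{h(a): y\ge a\in A\}: u\le y\in O(A^\delta)\}$. The canonical extension of a DLE $A$ is the lattice $A^\delta$ with operations $f^\sigma$ ($f\in\mathcal F$) and $g^\pi$ ($g\in\mathcal G$), where $f$ is regarded as an order-preserving map $A^{\varepsilon_f}\to A$ (similarly $g$), $A^\varepsilon$ being the product with $i$-th factor $A$ if $\varepsilon_i=1$ and the order-dual $A^\partial$ if $\varepsilon_i=\partial$, and $(A^{\varepsilon})^\delta$ is identified with $(A^\delta)^{\varepsilon}$. $\pi^{A^\delta}$ is the term function of $\pi$ on $A^\delta$. -}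

module Defs where

open import Level using (Level; Setω; suc; _⊔_)
open import Algebra.Core using (Op₂)
open import Algebra.Definitions using (_DistributesOverˡ_)
open import Algebra.Lattice.Bundles using (RawLattice)
open import Algebra.Lattice.Morphism.Structures using (IsLatticeMonomorphism)
open import Data.Fin.Base using (Fin)
open import Data.List.Base using (List; foldr)
open import Data.List.Relation.Unary.All using (All)
open import Data.Nat.Base using (ℕ; _+_)
open import Data.Nat.Divisibility using (_∣_)
open import Data.Product.Base using (∃; _×_; _,_)
open import Data.Vec.Functional using (updateAt)
open import Function.Base using (const; flip)
open import Relation.Binary.Core using (Rel)
open import Relation.Binary.Lattice
  using (IsBoundedLattice; DistributiveLattice)
open import Relation.Unary using (Pred; _∈_; _⊆_)
import Relation.Binary.Lattice.Properties.DistributiveLattice as DistributiveProperties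
import Relation.Binary.Lattice.Properties.Lattice as LatticeProperties

private
  variable
    o ℓ p x v w : Level
    n : ℕ

record BDL ℓ : Set (suc ℓ) where
  infix  4 _≈_ _≤_
  infixr 6 _∨_
  infixr 7 _∧_
  field
    Carrier          : Set ℓ
    _≈_              : Rel Carrier ℓ
    _≤_              : Rel Carrier ℓ
    _∨_              : Op₂ Carrier
    _∧_              : Op₂ Carrier
    ⊤                : Carrier
    ⊥                : Carrier
    isBoundedLattice : IsBoundedLattice _≈_ _≤_ _∨_ _∧_ ⊤ ⊥
    ∧-distribˡ-∨     : _DistributesOverˡ_ _≈_ _∧_ _∨_

  open IsBoundedLattice isBoundedLattice public

  distributiveLattice : DistributiveLattice ℓ ℓ ℓ
  distributiveLattice = record
    { isDistributiveLattice = record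
      { isLattice = isLattice ; ∧-distribˡ-∨ = ∧-distribˡ-∨ } }

  rawLattice : RawLattice ℓ ℓ
  rawLattice = record { _≈_ = _≈_ ; _∧_ = _∧_ ; _∨_ = _∨_ }

  ⋁ᶠ ⋀ᶠ : List Carrier → Carrier
  ⋁ᶠ = foldr _∨_ ⊥
  ⋀ᶠ = foldr _∧_ ⊤

  -- image h S is the set { h y | y ∈ S }.
  image : {X : Set x} → (X → Carrier) → Pred X p → Pred Carrier (x ⊔ ℓ ⊔ p)
  image h S c = ∃ λ y → y ∈ S × h y ≈ c

-- Completeness is required of subsets of every universe level, because
-- some of the sets whose joins are needed below are large: subsets of A
-- are taken at level ℓ, those of A^δ (as in J∞, M∞ and in denseness) at
-- level suc ℓ, where the sets K and O live, and then J∞ itself lives at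
-- level suc (suc ℓ).  Classically every subset is equivalent to a decidable
-- one, so that these distinctions vanish.
record CompleteBDL ℓ : Setω where
  field
    bdl : BDL ℓ
  open BDL bdl public
  field
    ⋁          : Pred Carrier p → Carrier
    ⋁-upper    : (S : Pred Carrier p) → ∀ {y} → y ∈ S → y ≤ ⋁ S
    ⋁-least    : (S : Pred Carrier p) → ∀ {u} → (∀ {y} → y ∈ S → y ≤ u) → ⋁ S ≤ u
    ⋀          : Pred Carrier p → Carrier
    ⋀-lower    : (S : Pred Carrier p) → ∀ {y} → y ∈ S → ⋀ S ≤ y
    ⋀-greatest : (S : Pred Carrier p) → ∀ {u} → (∀ {y} → y ∈ S → u ≤ y) → u ≤ ⋀ S

  -- Completely join- and meet-irreducible elements.  Taking S empty shows
  -- that ⊥ is not in J∞ and that ⊤ is not in M∞.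
  J∞ M∞ : Pred Carrier (suc (suc ℓ))
  J∞ i = (S : Pred Carrier (suc ℓ)) → i ≈ ⋁ S → ∃ λ s → s ∈ S × i ≈ s
  M∞ m = (S : Pred Carrier (suc ℓ)) → m ≈ ⋀ S → ∃ λ s → s ∈ S × m ≈ s

-- A complete lattice containing A as a bounded sublattice.
record Completion (A : BDL ℓ) : Setω where
  private module A = BDL A
  field
    completeBDL : CompleteBDL ℓ
  open CompleteBDL completeBDL public
  field
    ι                     : A.Carrier → Carrier
    isLatticeMonomorphism : IsLatticeMonomorphism A.rawLattice rawLattice ι
    ι-⊤                   : ι A.⊤ ≈ ⊤
    ι-⊥                   : ι A.⊥ ≈ ⊥

  K O : Pred Carrier (suc ℓ)
  K y = ∃ λ (S : Pred A.Carrier ℓ) → y ≈ ⋀ (image ι S)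
  O y = ∃ λ (S : Pred A.Carrier ℓ) → y ≈ ⋁ (image ι S)

record CanonicalExtension (A : BDL ℓ) : Setω where
  private module A = BDL A
  field
    completion : Completion A
  open Completion completion public
  field
    join-dense : ∀ u → ∃ λ (T : Pred Carrier (suc ℓ)) → T ⊆ K × u ≈ ⋁ T
    meet-dense : ∀ u → ∃ λ (T : Pred Carrier (suc ℓ)) → T ⊆ O × u ≈ ⋀ T
    compact    : (S T : Pred A.Carrier ℓ) →
                 ⋀ (image ι S) ≤ ⋁ (image ι T) →
                 ∃ λ (F : List A.Carrier) → ∃ λ (G : List A.Carrier) →
                 All (_∈ S) F × All (_∈ T) G × A.⋀ᶠ F A.≤ A.⋁ᶠ G

-- The formulas make sense for any h; they are of interest for order-preserving h.
module Extension {A B : BDL ℓ} (E : Completion A) (E′ : Completion B)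
                 (h : BDL.Carrier A → BDL.Carrier B) where
  private
    module E  = Completion E
    module E′ = Completion E′

  σ-ext : E.Carrier → E′.Carrier
  σ-ext u = E′.⋁ (E′.image
    (λ y → E′.⋀ (E′.image (λ a → E′.ι (h a)) (λ a → y E.≤ E.ι a)))
    (λ y → y ∈ E.K × y E.≤ u))

  π-ext : E.Carrier → E′.Carrier
  π-ext u = E′.⋀ (E′.image
    (λ y → E′.⋁ (E′.image (λ a → E′.ι (h a)) (λ a → E.ι a E.≤ y)))
    (λ y → y ∈ E.O × u E.≤ y))

open Extension public using (σ-ext; π-ext)

data OrderType : Set where
  𝟏 ∂ : OrderType

select : {X : Set x} → OrderType → X → X → X
select 𝟏 y z = y
select ∂ y z = z

-- A or its order-dual.  The carrier and the equality do not depend,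
-- definitionally, on the order-type.
orient : OrderType → BDL ℓ → BDL ℓ
orient ε A .BDL.Carrier = BDL.Carrier A
orient ε A .BDL._≈_     = BDL._≈_ A
orient ε A .BDL._≤_     = select ε (BDL._≤_ A) (flip (BDL._≤_ A))
orient ε A .BDL._∨_     = select ε (BDL._∨_ A) (BDL._∧_ A)
orient ε A .BDL._∧_     = select ε (BDL._∧_ A) (BDL._∨_ A)
orient ε A .BDL.⊤       = select ε (BDL.⊤ A) (BDL.⊥ A)
orient ε A .BDL.⊥       = select ε (BDL.⊥ A) (BDL.⊤ A)
orient 𝟏 A .BDL.isBoundedLattice = BDL.isBoundedLattice A
orient ∂ A .BDL.isBoundedLattice = record
  { isLattice = LatticeProperties.∧-∨-isLattice
                  (DistributiveLattice.lattice (BDL.distributiveLattice A))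
  ; maximum   = BDL.minimum A
  ; minimum   = BDL.maximum A
  }
orient 𝟏 A .BDL.∧-distribˡ-∨ = BDL.∧-distribˡ-∨ A
orient ∂ A .BDL.∧-distribˡ-∨ =
  DistributiveProperties.∨-distribˡ-∧ (BDL.distributiveLattice A)

Product : {I : Set} → (I → BDL ℓ) → BDL ℓ
Product {I = I} L = record
  { Carrier = ∀ i → L.Carrier i
  ; _≈_     = λ y z → ∀ i → L._≈_ i (y i) (z i)
  ; _≤_     = λ y z → ∀ i → L._≤_ i (y i) (z i)
  ; _∨_     = λ y z i → L._∨_ i (y i) (z i)
  ; _∧_     = λ y z i → L._∧_ i (y i) (z i)
  ; ⊤       = λ i → L.⊤ i
  ; ⊥       = λ i → L.⊥ i
  ; isBoundedLattice = record
    { isLattice = record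
      { isPartialOrder = record
        { isPreorder = record
          { isEquivalence = record
            { refl  = λ i → L.Eq.refl i
            ; sym   = λ e i → L.Eq.sym i (e i)
            ; trans = λ e e′ i → L.Eq.trans i (e i) (e′ i)
            }
          ; reflexive = λ e i → L.reflexive i (e i)
          ; trans     = λ r s i → L.trans i (r i) (s i)
          }
        ; antisym = λ r s i → L.antisym i (r i) (s i)
        }
      ; supremum = λ y z → (λ i → L.x≤x∨y i (y i) (z i))
                         , (λ i → L.y≤x∨y i (y i) (z i))
                         , (λ _ r s i → L.∨-least i (r i) (s i))
      ; infimum  = λ y z → (λ i → L.x∧y≤x i (y i) (z i))
                         , (λ i → L.x∧y≤y i (y i) (z i))
                         , (λ _ r s i → L.∧-greatest i (r i) (s i))
      }
    ; maximum = λ y i → L.maximum i (y i)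
    ; minimum = λ y i → L.minimum i (y i)
    }
  ; ∧-distribˡ-∨ = λ y z u i → L.∧-distribˡ-∨ i (y i) (z i) (u i)
  }
  where module L (i : I) = BDL (L i)

infixl 8 _^_ _^ᶜ_

_^_ : BDL ℓ → (Fin n → OrderType) → BDL ℓ
A ^ ε = Product (λ i → orient (ε i) A)

orientᶜ : {A : BDL ℓ} (ε : OrderType) → Completion A → Completion (orient ε A)
orientᶜ {ℓ = ℓ} {A} ε E = record
  { completeBDL = C ε
  ; ι           = E.ι
  ; isLatticeMonomorphism = record
    { isLatticeHomomorphism = record
      { isRelHomomorphism = record { cong = ⟦⟧-cong }
      ; ∧-homo = ∧-homo′ ε
      ; ∨-homo = ∨-homo′ ε
      }
    ; injective = injective
    }
  ; ι-⊤ = ι-⊤′ ε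
  ; ι-⊥ = ι-⊥′ ε
  }
  where
  module E = Completion E
  open IsLatticeMonomorphism E.isLatticeMonomorphism

  C : OrderType → CompleteBDL ℓ
  C ε .CompleteBDL.bdl        = orient ε E.bdl
  C ε .CompleteBDL.⋁ S        = select ε (E.⋁ S) (E.⋀ S)
  C ε .CompleteBDL.⋀ S        = select ε (E.⋀ S) (E.⋁ S)
  C 𝟏 .CompleteBDL.⋁-upper    = E.⋁-upper
  C ∂ .CompleteBDL.⋁-upper    = E.⋀-lower
  C 𝟏 .CompleteBDL.⋁-least    = E.⋁-least
  C ∂ .CompleteBDL.⋁-least    = E.⋀-greatest
  C 𝟏 .CompleteBDL.⋀-lower    = E.⋀-lower
  C ∂ .CompleteBDL.⋀-lower    = E.⋁-upper
  C 𝟏 .CompleteBDL.⋀-greatest = E.⋀-greatest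
  C ∂ .CompleteBDL.⋀-greatest = E.⋁-least

  module A (ε : OrderType) = BDL (orient ε A)
  module C (ε : OrderType) = CompleteBDL (C ε)

  ∧-homo′ : ∀ ε a b → E.ι (A._∧_ ε a b) E.≈ C._∧_ ε (E.ι a) (E.ι b)
  ∧-homo′ 𝟏 = ∧-homo
  ∧-homo′ ∂ = ∨-homo

  ∨-homo′ : ∀ ε a b → E.ι (A._∨_ ε a b) E.≈ C._∨_ ε (E.ι a) (E.ι b)
  ∨-homo′ 𝟏 = ∨-homo
  ∨-homo′ ∂ = ∧-homo

  ι-⊤′ : ∀ ε → E.ι (A.⊤ ε) E.≈ C.⊤ ε
  ι-⊤′ 𝟏 = E.ι-⊤
  ι-⊤′ ∂ = E.ι-⊥

  ι-⊥′ : ∀ ε → E.ι (A.⊥ ε) E.≈ C.⊥ ε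
  ι-⊥′ 𝟏 = E.ι-⊥
  ι-⊥′ ∂ = E.ι-⊤

Productᶜ : {I : Set} {L : I → BDL ℓ} →
           (∀ i → Completion (L i)) → Completion (Product L)
Productᶜ {ℓ = ℓ} {I = I} E = record
  { completeBDL = C
  ; ι           = λ a i → E.ι i (a i)
  ; isLatticeMonomorphism = record
    { isLatticeHomomorphism = record
      { isRelHomomorphism = record { cong = λ e i → ι.⟦⟧-cong i (e i) }
      ; ∧-homo = λ a b i → ι.∧-homo i (a i) (b i)
      ; ∨-homo = λ a b i → ι.∨-homo i (a i) (b i)
      }
    ; injective = λ e i → ι.injective i (e i)
    }
  ; ι-⊤ = λ i → E.ι-⊤ i
  ; ι-⊥ = λ i → E.ι-⊥ i
  }
  where
  module E (i : I) = Completion (E i)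
  module ι (i : I) = IsLatticeMonomorphism (E.isLatticeMonomorphism i)

  C : CompleteBDL ℓ
  C .CompleteBDL.bdl              = Product (λ i → E.bdl i)
  C .CompleteBDL.⋁ S i            = E.⋁ i (E.image i (λ y → y i) S)
  C .CompleteBDL.⋁-upper S y∈S i  = E.⋁-upper i _ (_ , y∈S , E.Eq.refl i)
  C .CompleteBDL.⋁-least S r i    = E.⋁-least i _
    λ { (_ , y∈S , e) → E.trans i (E.reflexive i (E.Eq.sym i e)) (r y∈S i) }
  C .CompleteBDL.⋀ S i            = E.⋀ i (E.image i (λ y → y i) S)
  C .CompleteBDL.⋀-lower S y∈S i  = E.⋀-lower i _ (_ , y∈S , E.Eq.refl i)
  C .CompleteBDL.⋀-greatest S r i = E.⋀-greatest i _
    λ { (_ , y∈S , e) → E.trans i (r y∈S i) (E.reflexive i e) }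

-- The completion (A^δ)^ε of A^ε; this is where (A^ε)^δ is identified
-- with (A^δ)^ε.
_^ᶜ_ : {A : BDL ℓ} → Completion A → (ε : Fin n → OrderType) → Completion (A ^ ε)
E ^ᶜ ε = Productᶜ (λ i → orientᶜ (ε i) E)

-- The two sets of connectives are disjoint by typing.
record Signature o : Set (suc o) where
  field
    F G : Set o
    nF  : F → ℕ
    nG  : G → ℕ
    εF  : (f : F) → Fin (nF f) → OrderType
    εG  : (g : G) → Fin (nG g) → OrderType

record Expansion (Sig : Signature o) ℓ : Set (o ⊔ suc ℓ) where
  open Signature Sig
  field
    bdl : BDL ℓ
  open BDL bdl public
  field
    ⟦_⟧F : (f : F) → (Fin (nF f) → Carrier) → Carrier
    ⟦_⟧G : (g : G) → (Fin (nG g) → Carrier) → Carrier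

_[_≔_] : {X : Set x} → (Fin n → X) → Fin n → X → Fin n → X
v [ i ≔ a ] = updateAt v i (const a)

-- The joins (meets) of coordinate i are taken in A^(ε i), so they are
-- meets (joins) of A if ε i is ∂.  Finite joins are reduced to the empty
-- and the binary ones.
module _ (A : BDL ℓ) (ε : Fin n → OrderType) (h : (Fin n → BDL.Carrier A) → BDL.Carrier A) where
  open BDL A
  private module Aε (i : Fin n) = BDL (orient (ε i) A)

  record IsOperator : Set ℓ where
    field
      cong   : ∀ {v w} → (∀ i → v i ≈ w i) → h v ≈ h w
      pres-⊥ : ∀ v i → h (v [ i ≔ Aε.⊥ i ]) ≈ ⊥
      pres-∨ : ∀ v i a b → h (v [ i ≔ Aε._∨_ i a b ]) ≈ h (v [ i ≔ a ]) ∨ h (v [ i ≔ b ])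

  record IsDualOperator : Set ℓ where
    field
      cong   : ∀ {v w} → (∀ i → v i ≈ w i) → h v ≈ h w
      pres-⊤ : ∀ v i → h (v [ i ≔ Aε.⊤ i ]) ≈ ⊤
      pres-∧ : ∀ v i a b → h (v [ i ≔ Aε._∧_ i a b ]) ≈ h (v [ i ≔ a ]) ∧ h (v [ i ≔ b ])

record DLE (Sig : Signature o) ℓ : Set (o ⊔ suc ℓ) where
  open Signature Sig
  field
    expansion : Expansion Sig ℓ
  open Expansion expansion public
  field
    F-isOperator     : ∀ f → IsOperator bdl (εF f) ⟦ f ⟧F
    G-isDualOperator : ∀ g → IsDualOperator bdl (εG g) ⟦ g ⟧G

canonicalExpansion : {Sig : Signature o} (A : DLE Sig ℓ) →
                     CanonicalExtension (DLE.bdl A) → Expansion Sig ℓ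
canonicalExpansion {Sig = Sig} A Aᵟ = record
  { bdl  = CanonicalExtension.bdl Aᵟ
  ; ⟦_⟧F = λ f → σ-ext (E ^ᶜ εF f) E A.⟦ f ⟧F
  ; ⟦_⟧G = λ g → π-ext (E ^ᶜ εG g) E A.⟦ g ⟧G
  }
  where
  open Signature Sig
  module A = DLE A
  E = CanonicalExtension.completion Aᵟ

module _ (Sig : Signature o) where
  open Signature Sig

  data Term (V : Set v) : Set (o ⊔ v) where
    var           : V → Term V
    ⊥ᵗ ⊤ᵗ         : Term V
    _∧ᵗ_ _∨ᵗ_     : Term V → Term V → Term V
    opF           : (f : F) → (Fin (nF f) → Term V) → Term V
    opG           : (g : G) → (Fin (nG g) → Term V) → Term V

module _ {Sig : Signature o} where
  open Signature Sig

  subst : {V : Set v} {W : Set w} → (V → Term Sig W) → Term Sig V → Term Sig W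
  subst τ (var y)    = τ y
  subst τ ⊥ᵗ         = ⊥ᵗ
  subst τ ⊤ᵗ         = ⊤ᵗ
  subst τ (s ∧ᵗ t)   = subst τ s ∧ᵗ subst τ t
  subst τ (s ∨ᵗ t)   = subst τ s ∨ᵗ subst τ t
  subst τ (opF f ts) = opF f (λ i → subst τ (ts i))
  subst τ (opG g ts) = opG g (λ i → subst τ (ts i))

  data Occurrence {V : Set v} (y : V) : Term Sig V → Set (o ⊔ v) where
    here : Occurrence y (var y)
    ∧ˡ   : ∀ {s t} → Occurrence y s → Occurrence y (s ∧ᵗ t)
    ∧ʳ   : ∀ {s t} → Occurrence y t → Occurrence y (s ∧ᵗ t)
    ∨ˡ   : ∀ {s t} → Occurrence y s → Occurrence y (s ∨ᵗ t)
    ∨ʳ   : ∀ {s t} → Occurrence y t → Occurrence y (s ∨ᵗ t)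
    inF  : ∀ {f ts} i → Occurrence y (ts i) → Occurrence y (opF f ts)
    inG  : ∀ {g ts} i → Occurrence y (ts i) → Occurrence y (opG g ts)

  -- The number of argument places of order-type ∂ above an occurrence.
  ∂-depth : {V : Set v} {y : V} {t : Term Sig V} → Occurrence y t → ℕ
  ∂-depth here               = 0
  ∂-depth (∧ˡ oc)            = ∂-depth oc
  ∂-depth (∧ʳ oc)            = ∂-depth oc
  ∂-depth (∨ˡ oc)            = ∂-depth oc
  ∂-depth (∨ʳ oc)            = ∂-depth oc
  ∂-depth (inF {f = f} i oc) = select (εF f i) 0 1 + ∂-depth oc
  ∂-depth (inG {g = g} i oc) = select (εG g i) 0 1 + ∂-depth oc

  Positive : {V : Set v} → V → Term Sig V → Set (o ⊔ v)
  Positive y t = (oc : Occurrence y t) → 2 ∣ ∂-depth oc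

module Semantics {Sig : Signature o} (A : Expansion Sig ℓ) where
  open Expansion A

  ⟦_⟧ : {V : Set v} → Term Sig V → (V → Carrier) → Carrier
  ⟦ var y ⟧    ρ = ρ y
  ⟦ ⊥ᵗ ⟧       ρ = ⊥
  ⟦ ⊤ᵗ ⟧       ρ = ⊤
  ⟦ s ∧ᵗ t ⟧   ρ = ⟦ s ⟧ ρ ∧ ⟦ t ⟧ ρ
  ⟦ s ∨ᵗ t ⟧   ρ = ⟦ s ⟧ ρ ∨ ⟦ t ⟧ ρ
  ⟦ opF f ts ⟧ ρ = ⟦ f ⟧F (λ i → ⟦ ts i ⟧ ρ)
  ⟦ opG g ts ⟧ ρ = ⟦ g ⟧G (λ i → ⟦ ts i ⟧ ρ)

  ⟦_⟧₁ : Term Sig (Fin 1) → Carrier → Carrier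
  ⟦ t ⟧₁ u = ⟦ t ⟧ (const u)

_⊨_≲_ : {Sig : Signature o} {V : Set v} →
        DLE Sig ℓ → Term Sig V → Term Sig V → Set (v ⊔ ℓ)
A ⊨ s ≲ t = ∀ ρ → ⟦ s ⟧ ρ ≤ ⟦ t ⟧ ρ
  where
  open DLE A
  open Semantics expansion

module CanonicalSemantics {Sig : Signature o} (A : DLE Sig ℓ)
                          (Aᵟ : CanonicalExtension (DLE.bdl A)) where
  open CanonicalExtension Aᵟ public
  open Semantics (canonicalExpansion A Aᵟ) public

  ■ : Term Sig (Fin 1) → Carrier → Carrier
  ■ π u = ⋁ (λ i → i ∈ J∞ × ⟦ π ⟧₁ i ≤ u)

-- A connective, extended by σ or by π, preserves the directed joins and the
-- filtered meets of elements of A in its arguments: this needs only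
-- compactness.  So do the binary lattice operations, by compactness and
-- denseness.  Hence so does every term function, a directed join becoming a
-- filtered meet if the term is negative.
--
-- Let u be the join of D = { a ∈ A | π(a) ≤ m }.  By additivity and
-- π(⊥) ≤ m, the set D is directed, so π(u) = ⋁ { π(a) | a ∈ D } ≤ m.
-- If i ∈ J∞ then i is closed, so π(i) is the filtered meet of the π(a) with
-- i ≤ a; as m is open, π(i) ≤ m yields by compactness some a ∈ D with i ≤ a.
-- Therefore ■ m ≤ u, and π(■ m) ≤ π(u) ≤ m.
module Submission where

open import Defs
open import Data.Fin.Base using (Fin; zero; suc)
open import Data.List.Base using (List; []; _∷_)
open import Data.List.Relation.Unary.All using (All; []; _∷_)
open import Data.Nat.Base using (ℕ; zero; suc; _+_; _*_)
open import Data.Nat.Divisibility using (_∣_; divides)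
open import Data.Product.Base using (∃; _×_; _,_; proj₁; proj₂)
open import Data.Unit.Polymorphic.Base using (tt) renaming (⊤ to 𝟙)
open import Data.Vec.Functional using () renaming (_∷_ to _∷ᶠ_)
open import Function.Base using (const; _∘_)
open import Level using (Level; _⊔_) renaming (suc to lsuc)
open import Relation.Binary.PropositionalEquality as ≡ using (_≡_; refl)
open import Relation.Unary using (Pred; _∈_; _⊆_)
open import Algebra.Lattice.Morphism.Structures using (IsLatticeMonomorphism)
open import Relation.Binary.Lattice using (DistributiveLattice)
import Relation.Binary.Lattice.Properties.JoinSemilattice as JoinProperties
import Relation.Binary.Lattice.Properties.MeetSemilattice as MeetProperties

private
  variable
    o ℓ i j v : Level
    n : ℕ
    I : Set i

-- Directed families in bounded distributive lattices.

module BDLProperties (A : BDL ℓ) where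
  open BDL A public
  open DistributiveLattice distributiveLattice public
    using (joinSemilattice; meetSemilattice)
  open JoinProperties joinSemilattice public
    using (∨-monotonic; ∨-cong; x≤y⇒x∨y≈y)
  open MeetProperties meetSemilattice public
    using (∧-monotonic; ∧-cong; y≤x⇒x∧y≈y)

module _ (A : BDL ℓ) where
  open BDL A

  -- Families rather than subsets, so that taking the image under a map is composition. Over
  -- `orient ∂ A` the notion becomes "filtered". The index in the first component expresses
  -- nonemptiness.
  Directed : {I : Set i} → (I → Carrier) → Set (i ⊔ ℓ)
  Directed {I = I} s = I × (∀ i j → ∃ λ k → s i ≤ s k × s j ≤ s k)

  directed-bound : {s : I → Carrier} → Directed s →
                   (c : Fin n → I) → ∃ λ k → ∀ r → s (c r) ≤ s k
  directed-bound {n = zero}  (i₀ , _) c = i₀ , λ ()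
  directed-bound {n = suc n} dir@(_ , bound) c =
    let k , below = directed-bound dir (c ∘ suc)
        l , c₀≤ , k≤ = bound (c zero) k
    in l , λ { zero → c₀≤ ; (suc r) → trans (below r) k≤ }

  ⋁ᶠ-bound : {s : I → Carrier} → Directed s → (F : List Carrier) →
             All (λ a → ∃ λ i → s i ≈ a) F → ∃ λ k → ⋁ᶠ F ≤ s k
  ⋁ᶠ-bound (i₀ , _) [] [] = i₀ , minimum _
  ⋁ᶠ-bound dir@(_ , bound) (a ∷ F) ((i , sᵢ≈a) ∷ all) =
    let k , F≤ = ⋁ᶠ-bound dir F all
        l , i≤ , k≤ = bound i k
    in l , ∨-least (trans (reflexive (Eq.sym sᵢ≈a)) i≤) (trans F≤ k≤)

Monotone : (A B : BDL ℓ) → (BDL.Carrier A → BDL.Carrier B) → Set ℓ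
Monotone A B h = ∀ {x y} → BDL._≤_ A x y → BDL._≤_ B (h x) (h y)

-- Reversing both orders changes nothing, but the orders unfold only once `e` is a constructor;
-- hence the case split with identical branches, here and in similar lemmas below.
orient-monotone : ∀ e (A B : BDL ℓ) {h} →
                  Monotone A B h → Monotone (orient e A) (orient e B) h
orient-monotone 𝟏 A B mono = mono
orient-monotone ∂ A B mono = mono

-- Joins, meets and compactness in a completion.

module CompletionProperties {A : BDL ℓ} (E : Completion A) where
  private module A = BDLProperties A
  open Completion E public
  open BDLProperties bdl public
    using (∧-monotonic; ∨-monotonic; y≤x⇒x∧y≈y; ∧-cong; ∨-cong)
  open IsLatticeMonomorphism isLatticeMonomorphism public
    using (∧-homo; ∨-homo; ⟦⟧-cong; injective)

  ι-mono : ∀ {a b} → a A.≤ b → ι a ≤ ι b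
  ι-mono {a} {b} a≤b = trans
    (reflexive (Eq.trans (⟦⟧-cong (A.Eq.sym (A.y≤x⇒x∧y≈y a≤b))) (∧-homo b a)))
    (x∧y≤x _ _)

  ι-reflects : ∀ {a b} → ι a ≤ ι b → a A.≤ b
  ι-reflects {a} {b} ιa≤ιb = A.trans
    (A.reflexive (A.Eq.sym (injective (Eq.trans (∧-homo b a) (y≤x⇒x∧y≈y ιa≤ιb)))))
    (A.x∧y≤x _ _)

  -- A relation instead of an equation with `⋁`: over `orientᶜ ∂ E` it turns into the statement
  -- about meets, so joins and meets are treated at once.
  Sup : {I : Set i} → (I → A.Carrier) → Carrier → Set (i ⊔ ℓ)
  Sup s u = (∀ i → ι (s i) ≤ u) × (∀ w → (∀ i → ι (s i) ≤ w) → u ≤ w)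

  upset : (y : Carrier) → (∃ λ a → y ≤ ι a) → A.Carrier
  upset y = proj₁

  upset-filtered : ∀ y → Directed (orient ∂ A) (upset y)
  upset-filtered y =
      (A.⊤ , trans (maximum y) (reflexive (Eq.sym ι-⊤)))
    , λ { (a , y≤a) (b , y≤b) →
          (a A.∧ b , trans (∧-greatest y≤a y≤b) (reflexive (Eq.sym (∧-homo a b))))
        , A.x∧y≤x a b , A.x∧y≤y a b }

  ι∈K : ∀ a → ι a ∈ K
  ι∈K a = (λ b → a A.≈ b) , antisym
    (⋀-greatest _ λ { (b , a≈b , ιb≈y) → reflexive (Eq.trans (⟦⟧-cong a≈b) ιb≈y) })
    (⋀-lower _ (a , A.Eq.refl , Eq.refl))

Sup : {A : BDL ℓ} (E : Completion A) {I : Set i} →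
      (I → BDL.Carrier A) → Completion.Carrier E → Set (i ⊔ ℓ)
Sup E = CompletionProperties.Sup E

Inf : {A : BDL ℓ} (E : Completion A) {I : Set i} →
      (I → BDL.Carrier A) → Completion.Carrier E → Set (i ⊔ ℓ)
Inf E = Sup (orientᶜ ∂ E)

module _ {A : BDL ℓ} (E : Completion A) where
  open CompletionProperties E hiding (Sup)

  -- The set whose meet is `y` consists of members of the upset. Over `orientᶜ ∂ E` this presents an
  -- open element as the directed join of the elements of `A` below it.
  upset-inf : ∀ {y} → y ∈ K → Inf E (upset y) y
  upset-inf (S , y≈⋀S) = proj₂
    , λ w w≤ → trans
        (⋀-greatest _ λ { (a , a∈S , ιa≈z) → trans
          (w≤ (a , trans (reflexive y≈⋀S) (⋀-lower _ (a , a∈S , Eq.refl))))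
          (reflexive ιa≈z) })
        (reflexive (Eq.sym y≈⋀S))

  inf∈K : {I : Set ℓ} {s : I → BDL.Carrier A} {u : Carrier} → Inf E s u → u ∈ K
  inf∈K {s = s} (u≤ , greatest) = (λ a → ∃ λ i → BDL._≈_ A (s i) a) , antisym
    (⋀-greatest _ λ { (a , (i , sᵢ≈a) , ιa≈z) →
      trans (u≤ i) (reflexive (Eq.trans (⟦⟧-cong sᵢ≈a) ιa≈z)) })
    (greatest _ λ i → ⋀-lower _ (s i , (i , BDL.Eq.refl A) , Eq.refl))

  ⋁-sup : (s : I → BDL.Carrier A) → Sup E s (⋁ (image (ι ∘ s) (λ (_ : I) → 𝟙 {ℓ})))
  ⋁-sup s = (λ i → ⋁-upper _ (i , tt , Eq.refl))
    , λ w s≤w → ⋁-least _ λ { (i , _ , ιsᵢ≈z) →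
        trans (reflexive (Eq.sym ιsᵢ≈z)) (s≤w i) }

-- Compactness, restricted to directed and filtered families so that no
-- finite subsets are involved.
DirectedCompact : {A : BDL ℓ} → Completion A → Set (lsuc ℓ)
DirectedCompact {ℓ = ℓ} {A = A} E =
  ∀ {I J : Set ℓ} {s : I → BDL.Carrier A} {t : J → BDL.Carrier A} {x y} →
  Directed (orient ∂ A) s → Directed A t → Inf E s x → Sup E t y →
  Completion._≤_ E x y → ∃ λ i → ∃ λ j → BDL._≤_ A (s i) (t j)

JoinDense : {A : BDL ℓ} → Completion A → Set (lsuc (lsuc ℓ))
JoinDense {ℓ = ℓ} E = ∀ u → ∃ λ (T : Pred Carrier (lsuc ℓ)) → T ⊆ K × u ≈ ⋁ T
  where open Completion E

-- The notion is self-dual: reversing the order exchanges the filtered and the directed family.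
orient-directedCompact : ∀ e {A : BDL ℓ} (E : Completion A) →
                         DirectedCompact E → DirectedCompact (orientᶜ e E)
orient-directedCompact 𝟏 E compact = compact
orient-directedCompact ∂ E compact filt dir inf sup x≤y =
  let j , i , tⱼ≤sᵢ = compact dir filt sup inf x≤y in i , j , tⱼ≤sᵢ

-- The finite sets supplied by compactness are each bounded by a single member of the family,
-- because the families are filtered and directed.
directedCompact : {A : BDL ℓ} (Aᵟ : CanonicalExtension A) →
                  DirectedCompact (CanonicalExtension.completion Aᵟ)
directedCompact {A = A} Aᵟ {s = s} {t} filt dir (_ , greatest) (_ , least) x≤y =
  let F , G , F⊆S , G⊆T , F≤G = CanonicalExtension.compact Aᵟ
        (λ a → ∃ λ i → s i A.≈ a) (λ a → ∃ λ j → t j A.≈ a)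
        (E.trans
          (greatest _ λ i → E.⋀-lower _ (s i , (i , A.Eq.refl) , E.Eq.refl))
          (E.trans x≤y
            (least _ λ j → E.⋁-upper _ (t j , (j , A.Eq.refl) , E.Eq.refl))))
      k , k≤F = ⋁ᶠ-bound (orient ∂ A) filt F F⊆S
      l , G≤l = ⋁ᶠ-bound A dir G G⊆T
  in k , l , A.trans k≤F (A.trans F≤G G≤l)
  where
  module A = BDL A
  module E = CanonicalExtension Aᵟ

-- Products of completions.

module _ {I : Set} {L : I → BDL ℓ} (E : ∀ r → Completion (L r)) where
  private
    module E (r : I) = Completion (E r)

  product-sup : ∀ e {J : Set j} {s : J → ∀ r → BDL.Carrier (L r)} {u} →
                (∀ r → Sup (orientᶜ e (E r)) (λ j → s j r) (u r)) →
                Sup (orientᶜ e (Productᶜ E)) s u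
  product-sup 𝟏 sup = (λ j r → proj₁ (sup r) j)
                    , (λ w s≤w r → proj₂ (sup r) (w r) (λ j → s≤w j r))
  product-sup ∂ sup = (λ j r → proj₁ (sup r) j)
                    , (λ w s≤w r → proj₂ (sup r) (w r) (λ j → s≤w j r))

  sup-coordinate : {J : Set j} {s : J → ∀ r → BDL.Carrier (L r)} {u : ∀ r → E.Carrier r} →
                   Sup (Productᶜ E) s u → ∀ r → Sup (E r) (λ j → s j r) (u r)
  sup-coordinate {J = J} {s} (s≤u , least) r = (λ j → s≤u j r)
    -- A bound `w` in one coordinate is not an element of the product. Leastness is therefore
    -- applied to the join of the whole family, which is computed coordinatewise and so lies below
    -- `w` at `r`.
    , λ w s≤w → E.trans r (least _ (λ j → P.⋁-upper S (j , P.Eq.refl)) r)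
        (E.⋁-least r _ λ { (_ , (j , ιsⱼ≈z) , zᵣ≈y) →
          E.trans r (E.reflexive r (E.Eq.sym r (E.Eq.trans r (ιsⱼ≈z r) zᵣ≈y))) (s≤w j) })
    where
    module P = Completion (Productᶜ E)
    S : Pred P.Carrier _
    S z = ∃ λ j → P.ι (s j) P.≈ z

  inf-coordinate : {J : Set j} {s : J → ∀ r → BDL.Carrier (L r)} {u : ∀ r → E.Carrier r} →
                   Inf (Productᶜ E) s u → ∀ r → Inf (E r) (λ j → s j r) (u r)
  inf-coordinate {J = J} {s} (u≤s , greatest) r = (λ j → u≤s j r)
    , λ w w≤s → E.trans r
        (E.⋀-greatest r _ λ { (_ , (j , ιsⱼ≈z) , zᵣ≈y) →
          E.trans r (w≤s j) (E.reflexive r (E.Eq.trans r (ιsⱼ≈z r) zᵣ≈y)) })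
        (greatest _ (λ j → P.⋀-lower S (j , P.Eq.refl)) r)
    where
    module P = Completion (Productᶜ E)
    S : Pred P.Carrier _
    S z = ∃ λ j → P.ι (s j) P.≈ z

-- Compactness in each factor yields a pair of indices per coordinate; as there are finitely many
-- coordinates, one lower and one upper index serve for all of them.
product-directedCompact :
  {L : Fin n → BDL ℓ} (E : ∀ r → Completion (L r)) →
  (∀ r → DirectedCompact (E r)) → DirectedCompact (Productᶜ E)
product-directedCompact {L = L} E compact {s = s} {t}
                        filt@(i₀ , lower) dir@(j₀ , upper) inf sup x≤y =
  let k , k≤ = directed-bound (orient ∂ (Product L)) filt (proj₁ ∘ separate)
      l , ≤l = directed-bound (Product L) dir (λ r → proj₁ (proj₂ (separate r)))
  in k , l , λ r → L.trans r (k≤ r r) (L.trans r (proj₂ (proj₂ (separate r))) (≤l r r))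
  where
  module L r = BDL (L r)
  separate : ∀ r → ∃ λ i → ∃ λ j → L._≤_ r (s i r) (t j r)
  separate r = compact r
    (i₀ , λ i i′ → let k , p , q = lower i i′ in k , p r , q r)
    (j₀ , λ j j′ → let k , p , q = upper j j′ in k , p r , q r)
    (inf-coordinate E inf r) (sup-coordinate E sup r) (x≤y r)

-- Limits under the extensions of a monotone map.

module _ {A B : BDL ℓ} (E : Completion A) (E′ : Completion B)
         {h : BDL.Carrier A → BDL.Carrier B} (h-mono : Monotone A B h)
         (compact : DirectedCompact E) where
  private
    module A  = BDL A
    module E  = CompletionProperties E
    module E′ = CompletionProperties E′

  -- Each `ι (s i)` is closed and thus takes part in the join defining `σ-ext`. Conversely, a closed
  -- `y` below `u` has, by compactness, an `a` in its upset below some `s i`.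
  σ-ext-sup : {I : Set ℓ} {s : I → A.Carrier} {u : E.Carrier} →
              Directed A s → Sup E s u → Sup E′ (h ∘ s) (σ-ext E E′ h u)
  σ-ext-sup {s = s} dir sup =
      (λ i → E′.trans
        (E′.⋀-greatest _ λ { (a , ιsᵢ≤ιa , e) → E′.trans
          (E′.ι-mono (h-mono (E.ι-reflects ιsᵢ≤ιa))) (E′.reflexive e) })
        (E′.⋁-upper _ (E.ι (s i) , (E.ι∈K (s i) , proj₁ sup i) , E′.Eq.refl)))
    , λ w hs≤w → E′.⋁-least _ λ { (y , (y∈K , y≤u) , e) →
        let (a , y≤ιa) , i , a≤sᵢ =
              compact (E.upset-filtered y) dir (upset-inf E y∈K) sup y≤u
        in E′.trans (E′.reflexive (E′.Eq.sym e))
             (E′.trans (E′.⋀-lower _ (a , y≤ιa , E′.Eq.refl))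
               (E′.trans (E′.ι-mono (h-mono a≤sᵢ)) (hs≤w i))) }

  -- Here `u` is itself closed, hence the largest `y` in the join defining `σ-ext`, and every
  -- element of `A` above `u` is above some `s i`.
  σ-ext-inf : {I : Set ℓ} {s : I → A.Carrier} {u : E.Carrier} →
              Directed (orient ∂ A) s → Inf E s u → Inf E′ (h ∘ s) (σ-ext E E′ h u)
  σ-ext-inf {s = s} {u} filt inf =
      (λ i → E′.⋁-least _ λ { (y , (_ , y≤u) , e) →
        E′.trans (E′.reflexive (E′.Eq.sym e))
          (E′.⋀-lower _ (s i , E.trans y≤u (proj₁ inf i) , E′.Eq.refl)) })
    , λ w w≤hs → E′.trans
        (E′.⋀-greatest _ λ { (a , u≤ιa , e) →
          -- `a` is viewed as the join of a one-element directed family, so that compactness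
          -- applies.
          let i , _ , sᵢ≤a = compact {J = 𝟙} {t = const a} filt
                (tt , λ _ _ → tt , A.refl , A.refl) inf
                ((λ _ → E.refl) , λ _ ιa≤w → ιa≤w tt) u≤ιa
          in E′.trans (w≤hs i) (E′.trans (E′.ι-mono (h-mono sᵢ≤a)) (E′.reflexive e)) })
        (E′.⋁-upper _ (u , (inf∈K E inf , E.refl) , E′.Eq.refl))

  σ-ext-limit : ∀ e {I : Set ℓ} {s : I → A.Carrier} {u : E.Carrier} →
                Directed (orient e A) s → Sup (orientᶜ e E) s u →
                Sup (orientᶜ e E′) (h ∘ s) (σ-ext E E′ h u)
  σ-ext-limit 𝟏 = σ-ext-sup
  σ-ext-limit ∂ = σ-ext-inf

-- The order-dual of π-ext is definitionally σ-ext.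
π-ext-limit : {A B : BDL ℓ} (E : Completion A) (E′ : Completion B)
              {h : BDL.Carrier A → BDL.Carrier B} → Monotone A B h → DirectedCompact E →
              ∀ e {I : Set ℓ} {s : I → BDL.Carrier A} {u} →
              Directed (orient e A) s → Sup (orientᶜ e E) s u →
              Sup (orientᶜ e E′) (h ∘ s) (π-ext E E′ h u)
π-ext-limit {A = A} {B} E E′ {h} mono compact = λ
  { 𝟏 → σ-ext-inf (orientᶜ ∂ E) (orientᶜ ∂ E′) {h} (orient-monotone ∂ A B mono) compact′
  ; ∂ → σ-ext-sup (orientᶜ ∂ E) (orientᶜ ∂ E′) {h} (orient-monotone ∂ A B mono) compact′ }
  where
  compact′ : DirectedCompact (orientᶜ ∂ E)
  compact′ = orient-directedCompact ∂ E compact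

module _ {A B : BDL ℓ} (E : Completion A) (E′ : Completion B)
         (h : BDL.Carrier A → BDL.Carrier B) where
  private
    module E  = Completion E
    module E′ = Completion E′

  σ-ext-monotone : Monotone E.bdl E′.bdl (σ-ext E E′ h)
  σ-ext-monotone u≤v = E′.⋁-least _ λ { (y , (y∈K , y≤u) , e) →
    E′.⋁-upper _ (y , (y∈K , E.trans y≤u u≤v) , e) }

  π-ext-monotone : Monotone E.bdl E′.bdl (π-ext E E′ h)
  π-ext-monotone u≤v = E′.⋀-greatest _ λ { (y , (y∈O , v≤y) , e) →
    E′.⋀-lower _ (y , (y∈O , E.trans u≤v v≤y) , e) }

-- Limits under the lattice operations.

module _ {A : BDL ℓ} (E : Completion A) where
  private
    module A = BDL A
  open CompletionProperties E hiding (Sup)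

  -- Denseness replaces here the infinite distributive law.
  ∧-sup : DirectedCompact E → JoinDense E → {I : Set ℓ} {s t : I → A.Carrier} {x y : Carrier} →
          Directed (Product {I = OrderType} (const A)) (λ i ε → select ε (s i) (t i)) →
          Sup E s x → Sup E t y → Sup E (λ i → s i A.∧ t i) (x ∧ y)
  ∧-sup compact dense {s = s} {t} {x} {y} (i₀ , bound) sup-s sup-t =
      (λ i → trans (reflexive (∧-homo _ _)) (∧-monotonic (proj₁ sup-s i) (proj₁ sup-t i)))
    , λ w st≤w →
        let T , T⊆K , x∧y≈⋁T = dense (x ∧ y)
            below : ∀ {z} → z ∈ T → z ≤ x ∧ y
            below z∈T = trans (⋁-upper T z∈T) (reflexive (Eq.sym x∧y≈⋁T))
        in trans (reflexive x∧y≈⋁T) (⋁-least T λ {z} z∈T →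
          let (a , z≤a) , i , a≤sᵢ = compact (upset-filtered z)
                (i₀ , λ i j → let k , p , q = bound i j in k , p 𝟏 , q 𝟏)
                (upset-inf E (T⊆K z∈T)) sup-s (trans (below z∈T) (x∧y≤x _ _))
              (b , z≤b) , j , b≤tⱼ = compact (upset-filtered z)
                (i₀ , λ i j → let k , p , q = bound i j in k , p ∂ , q ∂)
                (upset-inf E (T⊆K z∈T)) sup-t (trans (below z∈T) (x∧y≤y _ _))
              k , i≤k , j≤k = bound i j
          in trans (∧-greatest (trans z≤a (ι-mono (A.trans a≤sᵢ (i≤k 𝟏))))
                               (trans z≤b (ι-mono (A.trans b≤tⱼ (j≤k ∂)))))
               (trans (reflexive (Eq.sym (∧-homo _ _))) (st≤w k)))

  ∨-sup : {I : Set ℓ} {s t : I → A.Carrier} {x y : Carrier} →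
          Sup E s x → Sup E t y → Sup E (λ i → s i A.∨ t i) (x ∨ y)
  ∨-sup (s≤x , x-least) (t≤y , y-least) =
      (λ i → trans (reflexive (∨-homo _ _)) (∨-monotonic (s≤x i) (t≤y i)))
    , λ w st≤w → ∨-least
        (x-least w λ i → trans (ι-mono (A.x≤x∨y _ _)) (st≤w i))
        (y-least w λ i → trans (ι-mono (A.y≤x∨y _ _)) (st≤w i))

  constant-sup : {I : Set i} → I → ∀ {a x} → ι a ≈ x → Sup E (λ (_ : I) → a) x
  constant-sup i₀ ιa≈x = (λ _ → reflexive ιa≈x)
    , λ w ιa≤w → trans (reflexive (Eq.sym ιa≈x)) (ιa≤w i₀)

-- Monotonicity of the connectives on `A`.

module _ {X : Set v} (B : BDL ℓ) where
  open BDL B hiding (refl)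

  -- Coordinate `zero` is moved first; the others follow by induction for the map with head frozen
  -- at `w zero`. The updated and the reassembled vectors agree only pointwise, whence the
  -- congruence assumption. `R` may vary with the coordinate, as the orders of `A ^ ε` do.
  separately-monotone :
    (R : Fin n → X → X → Set ℓ) (h : (Fin n → X) → Carrier) →
    (∀ {v w} → (∀ r → v r ≡ w r) → h v ≤ h w) →
    (∀ v r {a b} → R r a b → h (v [ r ≔ a ]) ≤ h (v [ r ≔ b ])) →
    ∀ {v w} → (∀ r → R r (v r) (w r)) → h v ≤ h w
  separately-monotone {n = zero} R h h-cong mono vRw = h-cong λ ()
  separately-monotone {n = suc n} R h h-cong mono {v} {w} vRw =
    trans (h-cong λ { zero → refl ; (suc r) → refl })
      (trans (mono v zero (vRw zero))
        (trans (h-cong λ { zero → refl ; (suc r) → refl })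
          (trans (separately-monotone (R ∘ suc) (λ u → h (w zero ∷ᶠ u))
                   (λ e → h-cong λ { zero → refl ; (suc r) → e r })
                   (λ u r aRb → trans (h-cong λ { zero → refl ; (suc _) → refl })
                     (trans (mono (w zero ∷ᶠ u) (suc r) aRb)
                       (h-cong λ { zero → refl ; (suc _) → refl })))
                   (vRw ∘ suc))
            (h-cong λ { zero → refl ; (suc r) → refl }))))

module _ (A : BDL ℓ) (ε : Fin n → OrderType)
         {h : (Fin n → BDL.Carrier A) → BDL.Carrier A} where
  open BDL A
  private module Aε (r : Fin n) = BDLProperties (orient (ε r) A)

  private
    update-cong : ∀ {m} (v : Fin m → Carrier) r {a b} → a ≈ b →
                  ∀ i → (v [ r ≔ a ]) i ≈ (v [ r ≔ b ]) i
    update-cong v zero    a≈b zero    = a≈b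
    update-cong v zero    a≈b (suc i) = Eq.refl
    update-cong v (suc r) a≈b zero    = Eq.refl
    update-cong v (suc r) a≈b (suc i) = update-cong (v ∘ suc) r a≈b i

  operator-monotone : IsOperator A ε h → Monotone (A ^ ε) A h
  operator-monotone op = separately-monotone A (λ r → Aε._≤_ r) h
    (λ v≡w → reflexive (cong (λ r → Eq.reflexive (v≡w r))))
    λ v r {a} {b} a≤b → trans (x≤x∨y _ _) (reflexive (Eq.trans
      (Eq.sym (pres-∨ v r a b))
      (cong (update-cong v r (Aε.x≤y⇒x∨y≈y r a≤b)))))
    where open IsOperator op

  dualOperator-monotone : IsDualOperator A ε h → Monotone (A ^ ε) A h
  dualOperator-monotone op = separately-monotone A (λ r → Aε._≤_ r) h
    (λ v≡w → reflexive (cong (λ r → Eq.reflexive (v≡w r))))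
    λ v r {a} {b} a≤b → trans (reflexive (Eq.trans
      (cong (update-cong v r (Eq.sym (Aε.y≤x⇒x∧y≈y r a≤b))))
      (pres-∧ v r b a))) (x∧y≤x _ _)
    where open IsDualOperator op

-- Signs and iterated orientation.

infixr 7 _·_

_·_ : OrderType → OrderType → OrderType
𝟏 · ε = ε
∂ · 𝟏 = ∂
∂ · ∂ = 𝟏

sign : ℕ → OrderType
sign zero    = 𝟏
sign (suc n) = ∂ · sign n

sign-even : 2 ∣ n → sign n ≡ 𝟏
sign-even (divides q refl) = go q
  where
  go : ∀ q → sign (q * 2) ≡ 𝟏
  go zero = refl
  go (suc q) rewrite go q = refl

-- Descending through an argument place of order-type `ε` moves its sign from the depth to the
-- target orientation. This makes the inductions on terms close.
sign-select : ∀ ε e n → sign (select ε 0 1 + n) · e ≡ sign n · (e · ε)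
sign-select 𝟏 𝟏 n = refl
sign-select 𝟏 ∂ n = refl
sign-select ∂ 𝟏 n with sign n
... | 𝟏 = refl
... | ∂ = refl
sign-select ∂ ∂ n with sign n
... | 𝟏 = refl
... | ∂ = refl

-- By cases both sides unfold to the same relation. The two lattices may still differ in their proof
-- fields, so only relations are transported.
orient-orient-≤ : ∀ e ε (A : BDL ℓ) {x y} →
                  BDL._≤_ (orient (e · ε) A) x y → BDL._≤_ (orient e (orient ε A)) x y
orient-orient-≤ 𝟏 ε A x≤y = x≤y
orient-orient-≤ ∂ 𝟏 A x≤y = x≤y
orient-orient-≤ ∂ ∂ A x≤y = x≤y

orient-orient-sup : ∀ e ε {A : BDL ℓ} (E : Completion A) {s : I → BDL.Carrier A} {u} →
                    Sup (orientᶜ (e · ε) E) s u → Sup (orientᶜ e (orientᶜ ε E)) s u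
orient-orient-sup 𝟏 ε E sup = sup
orient-orient-sup ∂ 𝟏 E sup = sup
orient-orient-sup ∂ ∂ E sup = sup

orient-pointwise-≤ : ∀ e {I : Set} (L : I → BDL ℓ) {x y} →
                     (∀ r → BDL._≤_ (orient e (L r)) (x r) (y r)) →
                     BDL._≤_ (orient e (Product L)) x y
orient-pointwise-≤ 𝟏 L x≤y = x≤y
orient-pointwise-≤ ∂ L x≤y = x≤y

-- Term functions: monotonicity and limits.

module _ {Sig : Signature o} where
  open Signature Sig

  -- The sign condition under which the term function of t is monotone
  -- from A^d to A^e.
  Polar : OrderType → OrderType → Term Sig (Fin 1) → Set o
  Polar d e t = (oc : Occurrence zero t) → sign (∂-depth oc) · e ≡ d

  module _ {d e : OrderType} where

    polar-opF : ∀ {f ts} → Polar d e (opF f ts) → ∀ r → Polar d (e · εF f r) (ts r)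
    polar-opF {f} polar r oc =
      ≡.trans (≡.sym (sign-select (εF f r) e (∂-depth oc))) (polar (inF r oc))

    polar-opG : ∀ {g ts} → Polar d e (opG g ts) → ∀ r → Polar d (e · εG g r) (ts r)
    polar-opG {g} polar r oc =
      ≡.trans (≡.sym (sign-select (εG g r) e (∂-depth oc))) (polar (inG r oc))

  positive⇒polar : ∀ {t} e → Positive zero t → Polar e e t
  positive⇒polar e pos oc = ≡.cong (_· e) (sign-even (pos oc))

  module _ (A : Expansion Sig ℓ) where
    open Expansion A hiding (refl)
    open Semantics A
    open BDLProperties bdl using (∧-monotonic; ∨-monotonic)

    MonotoneConnectives : Set (o ⊔ ℓ)
    MonotoneConnectives = (∀ f → Monotone (bdl ^ εF f) bdl ⟦ f ⟧F)
                        × (∀ g → Monotone (bdl ^ εG g) bdl ⟦ g ⟧G)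

    -- Stated for any expansion with monotone connectives, so as to serve both `A` and its canonical
    -- extension. The source orientation `d` stays fixed while `e` is multiplied by the order-type
    -- of each argument place passed.
    term-monotone : MonotoneConnectives → ∀ d e t → Polar d e t →
                    Monotone (orient d bdl) (orient e bdl) ⟦ t ⟧₁
    term-monotone (F-mono , G-mono) d = go
      where
      go : ∀ e t → Polar d e t → Monotone (orient d bdl) (orient e bdl) ⟦ t ⟧₁
      -- The occurrence `here` has depth 0, so `polar here` says that `e` is `d`.
      go e (var zero) polar u≤v with refl ← polar here = u≤v
      go e ⊥ᵗ polar u≤v = BDL.refl (orient e bdl)
      go e ⊤ᵗ polar u≤v = BDL.refl (orient e bdl)
      go 𝟏 (s ∧ᵗ t) polar u≤v =
        ∧-monotonic (go 𝟏 s (polar ∘ ∧ˡ) u≤v) (go 𝟏 t (polar ∘ ∧ʳ) u≤v)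
      go ∂ (s ∧ᵗ t) polar u≤v =
        ∧-monotonic (go ∂ s (polar ∘ ∧ˡ) u≤v) (go ∂ t (polar ∘ ∧ʳ) u≤v)
      go 𝟏 (s ∨ᵗ t) polar u≤v =
        ∨-monotonic (go 𝟏 s (polar ∘ ∨ˡ) u≤v) (go 𝟏 t (polar ∘ ∨ʳ) u≤v)
      go ∂ (s ∨ᵗ t) polar u≤v =
        ∨-monotonic (go ∂ s (polar ∘ ∨ˡ) u≤v) (go ∂ t (polar ∘ ∨ʳ) u≤v)
      go e (opF f ts) polar u≤v = orient-monotone e (bdl ^ εF f) bdl (F-mono f)
        (orient-pointwise-≤ e (λ r → orient (εF f r) bdl) λ r →
          orient-orient-≤ e (εF f r) bdl (go (e · εF f r) (ts r) (polar-opF polar r) u≤v))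
      go e (opG g ts) polar u≤v = orient-monotone e (bdl ^ εG g) bdl (G-mono g)
        (orient-pointwise-≤ e (λ r → orient (εG g r) bdl) λ r →
          orient-orient-≤ e (εG g r) bdl (go (e · εG g r) (ts r) (polar-opG polar r) u≤v))

  module _ (A : DLE Sig ℓ) where
    private module A = DLE A
    open BDLProperties A.bdl using (∧-cong; ∨-cong)
    open Semantics A.expansion

    connectives-monotone : MonotoneConnectives A.expansion
    connectives-monotone = (λ f → operator-monotone A.bdl (εF f) (A.F-isOperator f))
                         , (λ g → dualOperator-monotone A.bdl (εG g) (A.G-isDualOperator g))

    ⟦subst⟧ : ∀ {w} {V : Set v} {W : Set w} (τ : V → Term Sig W) t ρ →
              ⟦ subst τ t ⟧ ρ A.≈ ⟦ t ⟧ (λ y → ⟦ τ y ⟧ ρ)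
    ⟦subst⟧ τ (var y)    ρ = A.Eq.refl
    ⟦subst⟧ τ ⊥ᵗ         ρ = A.Eq.refl
    ⟦subst⟧ τ ⊤ᵗ         ρ = A.Eq.refl
    ⟦subst⟧ τ (s ∧ᵗ t)   ρ = ∧-cong (⟦subst⟧ τ s ρ) (⟦subst⟧ τ t ρ)
    ⟦subst⟧ τ (s ∨ᵗ t)   ρ = ∨-cong (⟦subst⟧ τ s ρ) (⟦subst⟧ τ t ρ)
    ⟦subst⟧ τ (opF f ts) ρ = IsOperator.cong (A.F-isOperator f) λ r → ⟦subst⟧ τ (ts r) ρ
    ⟦subst⟧ τ (opG g ts) ρ = IsDualOperator.cong (A.G-isDualOperator g) λ r → ⟦subst⟧ τ (ts r) ρ

  module _ (A : DLE Sig ℓ) (Aᵟ : CanonicalExtension (DLE.bdl A)) where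
    private
      module A = DLE A
      module C = CanonicalExtension Aᵟ
      E = C.completion
      module T  = Semantics A.expansion
      module Tᵟ = Semantics (canonicalExpansion A Aᵟ)

      compact^ : (ε : Fin n → OrderType) → DirectedCompact (E ^ᶜ ε)
      compact^ ε = product-directedCompact (λ r → orientᶜ (ε r) E) λ r →
        orient-directedCompact (ε r) E (directedCompact Aᵟ)

    canonical-connectives-monotone : MonotoneConnectives (canonicalExpansion A Aᵟ)
    canonical-connectives-monotone =
        (λ f → σ-ext-monotone (E ^ᶜ εF f) E A.⟦ f ⟧F)
      , (λ g → π-ext-monotone (E ^ᶜ εG g) E A.⟦ g ⟧G)

    -- Induction on `t`: the extension of each connective preserves the limit of its arguments, and
    -- monotonicity on `A` keeps the families of arguments directed in the orientation required.
    term-limit : ∀ d {I : Set ℓ} {c : I → A.Carrier} {u} →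
                 Directed (orient d A.bdl) c → Sup (orientᶜ d E) c u →
                 ∀ e t → Polar d e t → Sup (orientᶜ e E) (λ i → T.⟦ t ⟧₁ (c i)) (Tᵟ.⟦ t ⟧₁ u)
    term-limit d {I} {c} {u} (i₀ , bound) sup = go
      where
      monotone : ∀ e t → Polar d e t → Monotone (orient d A.bdl) (orient e A.bdl) T.⟦ t ⟧₁
      monotone = term-monotone A.expansion (connectives-monotone A) d

      directed : ∀ e {m} (ε : Fin m → OrderType) (ts : Fin m → Term Sig (Fin 1)) →
                 (∀ r → Polar d (e · ε r) (ts r)) →
                 Directed (orient e (A.bdl ^ ε)) (λ i r → T.⟦ ts r ⟧₁ (c i))
      directed e ε ts polar = i₀ , λ i j →
        let k , i≤k , j≤k = bound i j in k , image-≤ i≤k , image-≤ j≤k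
        where
        image-≤ : ∀ {a b} → BDL._≤_ (orient d A.bdl) a b →
                  BDL._≤_ (orient e (A.bdl ^ ε)) (λ r → T.⟦ ts r ⟧₁ a) (λ r → T.⟦ ts r ⟧₁ b)
        image-≤ a≤b = orient-pointwise-≤ e (λ r → orient (ε r) A.bdl) λ r →
          orient-orient-≤ e (ε r) A.bdl (monotone (e · ε r) (ts r) (polar r) a≤b)

      -- Joint directedness: one index bounds both values. `OrderType` serves merely as a
      -- two-element index set.
      pair : ∀ e s t → Polar d e s → Polar d e t →
             Directed (Product {I = OrderType} (const (orient e A.bdl)))
                      (λ i ε → select ε (T.⟦ s ⟧₁ (c i)) (T.⟦ t ⟧₁ (c i)))
      pair e s t s-polar t-polar = i₀ , λ i j →
        let k , i≤k , j≤k = bound i j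
        in k , (λ { 𝟏 → monotone e s s-polar i≤k ; ∂ → monotone e t t-polar i≤k })
             , (λ { 𝟏 → monotone e s s-polar j≤k ; ∂ → monotone e t t-polar j≤k })

      go : ∀ e t → Polar d e t → Sup (orientᶜ e E) (λ i → T.⟦ t ⟧₁ (c i)) (Tᵟ.⟦ t ⟧₁ u)
      go e (var zero) polar with refl ← polar here = sup
      go e ⊥ᵗ polar = constant-sup (orientᶜ e E) i₀ C.ι-⊥
      go e ⊤ᵗ polar = constant-sup (orientᶜ e E) i₀ C.ι-⊤
      go 𝟏 (s ∧ᵗ t) polar = ∧-sup E (directedCompact Aᵟ) C.join-dense
        (pair 𝟏 s t (polar ∘ ∧ˡ) (polar ∘ ∧ʳ)) (go 𝟏 s (polar ∘ ∧ˡ)) (go 𝟏 t (polar ∘ ∧ʳ))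
      go ∂ (s ∧ᵗ t) polar =
        ∨-sup (orientᶜ ∂ E) (go ∂ s (polar ∘ ∧ˡ)) (go ∂ t (polar ∘ ∧ʳ))
      go 𝟏 (s ∨ᵗ t) polar = ∨-sup E (go 𝟏 s (polar ∘ ∨ˡ)) (go 𝟏 t (polar ∘ ∨ʳ))
      go ∂ (s ∨ᵗ t) polar =
        -- In the dual, `∨` is the meet, and join-denseness there unfolds to `meet-dense`.
        ∧-sup (orientᶜ ∂ E) (orient-directedCompact ∂ E (directedCompact Aᵟ)) C.meet-dense
          (pair ∂ s t (polar ∘ ∨ˡ) (polar ∘ ∨ʳ)) (go ∂ s (polar ∘ ∨ˡ)) (go ∂ t (polar ∘ ∨ʳ))
      go e (opF f ts) polar =
        σ-ext-limit (E ^ᶜ εF f) E (proj₁ (connectives-monotone A) f) (compact^ (εF f)) e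
          (directed e (εF f) ts (polar-opF polar))
          (product-sup (λ r → orientᶜ (εF f r) E) e λ r →
            orient-orient-sup e (εF f r) E (go (e · εF f r) (ts r) (polar-opF polar r)))
      go e (opG g ts) polar =
        π-ext-limit (E ^ᶜ εG g) E (proj₂ (connectives-monotone A) g) (compact^ (εG g)) e
          (directed e (εG g) ts (polar-opG polar))
          (product-sup (λ r → orientᶜ (εG g r) E) e λ r →
            orient-orient-sup e (εG g r) E (go (e · εG g r) (ts r) (polar-opG polar r)))

-- Irreducible elements and the final inequality.

module _ {A : BDL ℓ} (Aᵟ : CanonicalExtension A) where
  open CanonicalExtension Aᵟ

  -- Irreducibility, applied to a representation as a join of closed elements, makes the element
  -- equal to one of them.
  J∞⊆K : J∞ ⊆ K
  J∞⊆K {i} i∈J∞ =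
    let T , T⊆K , i≈⋁T = join-dense i
        s , s∈T , i≈s  = i∈J∞ T i≈⋁T
        S , s≈⋀S       = T⊆K s∈T
    in S , Eq.trans i≈s s≈⋀S

  M∞⊆O : M∞ ⊆ O
  M∞⊆O {m} m∈M∞ =
    let T , T⊆O , m≈⋀T = meet-dense m
        s , s∈T , m≈s  = m∈M∞ T m≈⋀T
        S , s≈⋁S       = T⊆O s∈T
    in S , Eq.trans m≈s s≈⋁S

proposition18 : ∀ {o ℓ : Level} {Sig : Signature o}
    (π : Term Sig (Fin 1)) → Positive zero π →
    (A : DLE Sig ℓ) →
    let p : Term Sig (Fin 2)
        p = var zero
        q : Term Sig (Fin 2)
        q = var (suc zero)
    in
    A ⊨ subst (const (p ∨ᵗ q)) π ≲ (subst (const p) π ∨ᵗ subst (const q) π) →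
    (Aᵟ : CanonicalExtension (DLE.bdl A)) →
    let open CanonicalSemantics A Aᵟ in
    ∀ m → m ∈ M∞ → ⟦ π ⟧₁ ⊥ ≤ m → ⟦ π ⟧₁ (■ π m) ≤ m
proposition18 {ℓ = ℓ} {Sig = Sig} π positive A additive Aᵟ m m∈M∞ π⊥≤m =
  -- The last `proj₂` is the membership proof in `D`: it shows `m` to be an upper bound of the
  -- values of `π` on `D`.
  C.trans (πᵟ-monotone ■m≤u) (proj₂ (term-limit A Aᵟ 𝟏 D-directed D-sup 𝟏 π (polar 𝟏)) m proj₂)
  where
  module A = DLE A
  module C = CompletionProperties (CanonicalExtension.completion Aᵟ)
  open Semantics A.expansion using (⟦_⟧₁)
  open CanonicalSemantics A Aᵟ using (■; J∞) renaming (⟦_⟧₁ to ⟦_⟧₁ᵟ)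
  E = CanonicalExtension.completion Aᵟ

  polar : ∀ e → Polar e e π
  polar e = positive⇒polar e positive

  πᵟ-monotone : Monotone C.bdl C.bdl ⟦ π ⟧₁ᵟ
  πᵟ-monotone = term-monotone (canonicalExpansion A Aᵟ)
    (canonical-connectives-monotone A Aᵟ) 𝟏 𝟏 π (polar 𝟏)

  π-∨ : ∀ a b → ⟦ π ⟧₁ (a A.∨ b) A.≤ ⟦ π ⟧₁ a A.∨ ⟦ π ⟧₁ b
  π-∨ a b = A.trans (A.reflexive (A.Eq.sym (⟦subst⟧ A _ π ρ)))
    (A.trans (additive ρ)
      (A.reflexive (BDLProperties.∨-cong A.bdl (⟦subst⟧ A _ π ρ) (⟦subst⟧ A _ π ρ))))
    where
    ρ : Fin 2 → A.Carrier
    ρ zero    = a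
    ρ (suc _) = b

  ιπ⊥≤m : C.ι (⟦ π ⟧₁ A.⊥) C.≤ m
  ιπ⊥≤m = C.trans
    -- A one-element family at `A.⊥` compares the value of `π` in `A` with its value in the
    -- extension.
    (proj₁ (term-limit A Aᵟ 𝟏 {I = 𝟙} (tt , λ _ _ → tt , A.refl , A.refl)
      (constant-sup E tt C.ι-⊥) 𝟏 π (polar 𝟏)) tt)
    π⊥≤m

  D : Set ℓ
  D = ∃ λ a → C.ι (⟦ π ⟧₁ a) C.≤ m

  u : C.Carrier
  u = C.⋁ (C.image (λ (a : D) → C.ι (proj₁ a)) (λ _ → 𝟙 {ℓ}))

  D-sup : Sup E {I = D} proj₁ u
  D-sup = ⋁-sup E proj₁

  D-directed : Directed A.bdl {I = D} proj₁
  D-directed = (A.⊥ , ιπ⊥≤m) , λ { (a , πa≤m) (b , πb≤m) →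
      (a A.∨ b , C.trans (C.ι-mono (π-∨ a b))
        (C.trans (C.reflexive (C.∨-homo _ _)) (C.∨-least πa≤m πb≤m)))
    , A.x≤x∨y a b , A.y≤x∨y a b }

  ■m≤u : ■ π m C.≤ u
  ■m≤u = C.⋁-least _ λ { {i} (i∈J∞ , πi≤m) →
    -- Compactness separates the filtered family of the `π` values above `i`, with meet the value at
    -- `i`, from the directed family of elements of `A` below `m`, with join `m`. The resulting `a`
    -- belongs to `D`.
    let (a , i≤a) , (b , b≤m) , πa≤b = directedCompact Aᵟ
          (i-image-filtered i) (CompletionProperties.upset-filtered (orientᶜ ∂ E) m)
          (term-limit A Aᵟ ∂ (C.upset-filtered i) (upset-inf E (J∞⊆K Aᵟ i∈J∞)) ∂ π (polar ∂))
          (upset-inf (orientᶜ ∂ E) (M∞⊆O Aᵟ m∈M∞))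
          πi≤m
    in C.trans i≤a (proj₁ D-sup (a , C.trans (C.ι-mono πa≤b) b≤m)) }
    where
    i-image-filtered : ∀ i → Directed (orient ∂ A.bdl) (⟦ π ⟧₁ ∘ C.upset i)
    i-image-filtered i =
      let a , bound = C.upset-filtered i
          mono : Monotone A.bdl A.bdl ⟦ π ⟧₁
          mono = term-monotone A.expansion (connectives-monotone A) 𝟏 𝟏 π (polar 𝟏)
      in a , λ j k → let l , p , q = bound j k in l , mono p , mono q
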